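{- For an integer $N\ge 0$ define the polynomials in $q$ $$S(2,3;q,N)=\sum_{m,n\ge 0}q^{m^2+3mn+3n^2+2m+3n}\begin{bmatrix}N-3n-m-1\\ m\end{bmatrix}_q^{\star}\begin{bmatrix}\lfloor\frac23N\rfloor-m-n\\ n\end{bmatrix}_{q^3},$$ $$S(3,6;q,N)=\sum_{m,n\ge 0}q^{m^2+3mn+3n^2+3m+6n}\begin{bmatrix}N-3n-m-2\\ m\end{bmatrix}_q\begin{bmatrix}\lfloor\frac23N\rfloor-1-m-n\\ n\end{bmatrix}_{q^3},$$ $$S(0,-1;q,N)=\sum_{m,n\ge 0}q^{m^2+3mn+3n^2-n}\begin{bmatrix}N+1-3n-m\\ m\end{bmatrix}_q\begin{bmatrix}\lfloor\frac23(N+2)\rfloor-m-n\\ n\end{bmatrix}_{q^3},$$ $$S(3,5;q,N)=\sum_{m,n\ge 0}q^{m^2+3mn+3n^2+3m+5n}\begin{bmatrix}N-3n-m-2\\ m\end{bmatrix}_q\begin{bmatrix}\lfloor\frac23(N-1)\rfloor-m-n\\ n\end{bmatrix}_{q^3},$$ and let $S(1,3;q,N):=S(2,3;q,N)+q^2S(3,6;q,N)$ and $S(0,2;q,N):=S(0,-1;q,N)-q^2S(3,5;q,N)$. Then $$S(1,3;q,N)=\sum_{m,n\ge 0}q^{m^2+3mn+3n^2+m+3n}\begin{bmatrix}N-m-3n\\ m\end{bmatrix}_q\begin{bmatrix}\lfloor\frac23N\rfloor-m-n\\ n\end{bmatrix}_{q^3},$$ $$S(0,2;q,N)=\sum_{m,n\ge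 0}q^{m^2+3mn+3n^2+2n}\begin{bmatrix}N+1-m-3n\\ m\end{bmatrix}_q\begin{bmatrix}\lfloor\frac23(N-1)\rfloor+1-m-n\\ n\end{bmatrix}_{q^3}.$$
   Context: Notation: $(x;q)_n=\prod_{i=0}^{n-1}(1-q^ix)$. For $k,l\in\mathbb{Z}$ the Gaussian binomial coefficient is $\begin{bmatrix}k\\ l\end{bmatrix}_q=\frac{(q;q)_k}{(q;q)_l(q;q)_{k-l}}$ if $k\ge l\ge 0$, and $0$ if $l<0$ or $k<l$; the subscript $q^3$ means that $q$ is replaced by $q^3$. The starred coefficient $\begin{bmatrix}k\\ l\end{bmatrix}_q^{\star}$ equals $\begin{bmatrix}k\\ l\end{bmatrix}_q$ except that $\begin{bmatrix}-1\\ 0\end{bmatrix}_q^{\star}=1$. $\lfloor x\rfloor$ is the greatest integer $\le x$. -}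

module Defs where

open import Data.Bool.Base using (true; false; if_then_else_)
open import Data.Fin.Base using (toℕ)
open import Data.Integer.Base as ℤ using (ℤ; +_; -[1+_]; 0ℤ; 1ℤ)
import Data.Integer.Properties as ℤ
open import Data.Integer.Tactic.RingSolver using (solve-∀)
open import Data.Nat.Base as ℕ using (ℕ; zero; suc; _∸_)
import Data.Nat.Properties as ℕ
open import Data.Rational.Unnormalised.Base as ℚᵘ using (_/_; floor)
open import Data.Sum.Base using (_⊎_; inj₁; inj₂)
open import Relation.Binary.PropositionalEquality
open import Relation.Nullary.Negation using (contradiction)

open import Algebra.Properties.Semiring.Sum ℤ.+-*-semiring public
  using () renaming (sum to ∑)

-- Polynomials in q are compared inside the ring ℤ[[q]], in which ℤ[q] embeds and in which
-- the quotients defining the Gaussian coefficients make sense: f d is the coefficient of q^d.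
Series : Set
Series = ℕ → ℤ

infix  4 _≈_
infixl 6 _+ˢ_ _-ˢ_
infixl 7 _*ˢ_ _÷ˢ_
infixr 8 _^ˢ_

_≈_ : Series → Series → Set
f ≈ g = ∀ d → f d ≡ g d

0ˢ 1ˢ q : Series
0ˢ _ = 0ℤ

1ˢ zero    = 1ℤ
1ˢ (suc _) = 0ℤ

q zero    = 0ℤ
q (suc d) = 1ˢ d

_+ˢ_ _-ˢ_ _*ˢ_ _÷ˢ_ : Series → Series → Series
(f +ˢ g) d = f d ℤ.+ g d
(f -ˢ g) d = f d ℤ.- g d
(f *ˢ g) d = ∑ {suc d} (λ i → f (toℕ i) ℤ.* g (d ∸ toℕ i))

-- Long division in ascending powers of q; it computes the quotient f / g when g has
-- constant term 1 (see ÷ˢ-correct), the only case in which it is used.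
(f ÷ˢ g) zero    = f 0
(f ÷ˢ g) (suc d) = ((λ e → f (suc e) ℤ.- f 0 ℤ.* g (suc e)) ÷ˢ g) d

÷ˢ-correct : ∀ f g → g 0 ≡ 1ℤ → (f ÷ˢ g) *ˢ g ≈ f
÷ˢ-correct f g g₀≡1 zero = begin
  f 0 ℤ.* g 0 ℤ.+ 0ℤ  ≡⟨ ℤ.+-identityʳ _ ⟩
  f 0 ℤ.* g 0         ≡⟨ cong (f 0 ℤ.*_) g₀≡1 ⟩
  f 0 ℤ.* 1ℤ          ≡⟨ ℤ.*-identityʳ _ ⟩
  f 0                 ∎
  where open ≡-Reasoning
÷ˢ-correct f g g₀≡1 (suc d) = begin
  c ℤ.+ (r ÷ˢ g *ˢ g) d                 ≡⟨ cong (λ z → c ℤ.+ z) (÷ˢ-correct r g g₀≡1 d) ⟩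
  c ℤ.+ (f (suc d) ℤ.- c)               ≡⟨ ℤ.+-comm c _ ⟩
  f (suc d) ℤ.- c ℤ.+ c                 ≡⟨ ℤ.+-assoc (f (suc d)) (ℤ.- c) c ⟩
  f (suc d) ℤ.+ (ℤ.- c ℤ.+ c)           ≡⟨ cong (λ z → f (suc d) ℤ.+ z) (ℤ.+-inverseˡ c) ⟩
  f (suc d) ℤ.+ 0ℤ                      ≡⟨ ℤ.+-identityʳ _ ⟩
  f (suc d)                             ∎
  where
  open ≡-Reasoning
  c = f 0 ℤ.* g (suc d)
  r : Series
  r e = f (suc e) ℤ.- f 0 ℤ.* g (suc e)

_^ˢ_ : Series → ℕ → Series
f ^ˢ zero  = 1ˢ
f ^ˢ suc n = f ^ˢ n *ˢ f

pochhammer : (x p : Series) → ℕ → Series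
pochhammer x p zero    = 1ˢ
pochhammer x p (suc n) = pochhammer x p n *ˢ (1ˢ -ˢ p ^ˢ n *ˢ x)

private
  *ˢ-const : ∀ f g → (f *ˢ g) 0 ≡ f 0 ℤ.* g 0
  *ˢ-const f g = ℤ.+-identityʳ _

pochhammer-const : ∀ p n → p 0 ≡ 0ℤ → pochhammer p p n 0 ≡ 1ℤ
pochhammer-const p zero    p₀≡0 = refl
pochhammer-const p (suc n) p₀≡0 = begin
  pochhammer p p (suc n) 0                                   ≡⟨ *ˢ-const (pochhammer p p n) (1ˢ -ˢ p ^ˢ n *ˢ p) ⟩
  pochhammer p p n 0 ℤ.* (1ℤ ℤ.- (p ^ˢ n *ˢ p) 0)            ≡⟨ cong₂ (λ y z → y ℤ.* (1ℤ ℤ.- z)) (pochhammer-const p n p₀≡0) pⁿp₀≡0 ⟩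
  1ℤ                                                         ∎
  where
  open ≡-Reasoning
  pⁿp₀≡0 : (p ^ˢ n *ˢ p) 0 ≡ 0ℤ
  pⁿp₀≡0 = trans (*ˢ-const (p ^ˢ n) p) (trans (cong ((p ^ˢ n) 0 ℤ.*_) p₀≡0) (ℤ.*-zeroʳ ((p ^ˢ n) 0)))

-- The base p stands for q or q³. The last clause covers k < 0 or l < 0.
binom : (p : Series) (k l : ℤ) → Series
binom p (+ k) (+ l) =
  if l ℕ.≤ᵇ k
  then pochhammer p p k ÷ˢ (pochhammer p p l *ˢ pochhammer p p (k ∸ l))
  else 0ˢ
binom p _     _     = 0ˢ

binom-quotient : ∀ p {k l} → p 0 ≡ 0ℤ → l ℕ.≤ k →
  binom p (+ k) (+ l) *ˢ (pochhammer p p l *ˢ pochhammer p p (k ∸ l)) ≈ pochhammer p p k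
binom-quotient p {k} {l} p₀≡0 l≤k with l ℕ.≤ᵇ k | ℕ.≤⇒≤ᵇ l≤k
... | true | _ = ÷ˢ-correct
  (pochhammer p p k) (pochhammer p p l *ˢ pochhammer p p (k ∸ l))
  (trans (*ˢ-const (pochhammer p p l) (pochhammer p p (k ∸ l)))
         (cong₂ ℤ._*_ (pochhammer-const p l p₀≡0) (pochhammer-const p (k ∸ l) p₀≡0)))

binom★ : (p : Series) (k l : ℤ) → Series
binom★ p -[1+ 0 ] (+ 0) = 1ˢ
binom★ p k        l     = binom p k l

private
  binom-below : ∀ p k m → k ℤ.< + m → binom p k (+ m) ≡ 0ˢ
  binom-below p -[1+ _ ] m _ = refl
  binom-below p (+ k)    m (ℤ.+<+ k<m) with m ℕ.≤ᵇ k | ℕ.≤ᵇ⇒≤ m k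
  ... | false | _   = refl
  ... | true  | m≤k = contradiction (m≤k _) (ℕ.<⇒≱ k<m)

  upper-entry : ∀ N m n k → k ℤ.≤ + N ℤ.+ + 1 ℤ.- + 3 ℤ.* + n ℤ.- + m →
    k ℤ.+ + (m ℕ.+ 3 ℕ.* n) ℤ.≤ + (N ℕ.+ 1)
  upper-entry N m n k k≤ = begin
    k ℤ.+ + (m ℕ.+ 3 ℕ.* n)                                    ≤⟨ ℤ.+-monoˡ-≤ (+ (m ℕ.+ 3 ℕ.* n)) k≤ ⟩
    + N ℤ.+ + 1 ℤ.- + 3 ℤ.* + n ℤ.- + m ℤ.+ + (m ℕ.+ 3 ℕ.* n)  ≡⟨ cong (λ z → + N ℤ.+ + 1 ℤ.- + 3 ℤ.* + n ℤ.- + m ℤ.+ (+ m ℤ.+ z)) (ℤ.pos-* 3 n) ⟩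
    + N ℤ.+ + 1 ℤ.- + 3 ℤ.* + n ℤ.- + m ℤ.+ (+ m ℤ.+ + 3 ℤ.* + n) ≡⟨ cancel (+ N) (+ 3 ℤ.* + n) (+ m) ⟩
    + (N ℕ.+ 1)                                                ∎
    where
    open ℤ.≤-Reasoning
    cancel : ∀ a b c → a ℤ.+ + 1 ℤ.- b ℤ.- c ℤ.+ (c ℤ.+ b) ≡ a ℤ.+ + 1
    cancel = solve-∀

  outside : ∀ {N m n} → suc N ℕ.< m ⊎ suc N ℕ.< n → N ℕ.+ 1 ℕ.< m ℕ.+ 3 ℕ.* n
  outside {N} {m} {n} (inj₁ N<m) rewrite ℕ.+-comm N 1 = ℕ.≤-trans N<m (ℕ.m≤m+n m _)
  outside {N} {m} {n} (inj₂ N<n) rewrite ℕ.+-comm N 1 =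
    ℕ.≤-trans N<n (ℕ.≤-trans (ℕ.m≤m+n n _) (ℕ.m≤n+m (3 ℕ.* n) m))

  upper-entry-negative : ∀ N m n k → suc N ℕ.< m ⊎ suc N ℕ.< n →
    k ℤ.≤ + N ℤ.+ + 1 ℤ.- + 3 ℤ.* + n ℤ.- + m → k ℤ.< 0ℤ
  upper-entry-negative N m n -[1+ _ ] out k≤ = ℤ.-<+
  upper-entry-negative N m n (+ k) out k≤ = contradiction
    (ℕ.≤-trans (ℕ.m≤n+m _ k) (ℤ.drop‿+≤+ (upper-entry N m n (+ k) k≤)))
    (ℕ.<⇒≱ (outside out))

binom-vanishes : ∀ p N m n k → suc N ℕ.< m ⊎ suc N ℕ.< n →
  k ℤ.≤ + N ℤ.+ + 1 ℤ.- + 3 ℤ.* + n ℤ.- + m → binom p k (+ m) ≡ 0ˢ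
binom-vanishes p N m n k out k≤ =
  binom-below p k m (ℤ.<-≤-trans (upper-entry-negative N m n k out k≤) (ℤ.+≤+ ℕ.z≤n))

binom★-vanishes : ∀ p N m n k → suc N ℕ.< m ⊎ suc N ℕ.< n →
  k ℤ.+ + 2 ℤ.≤ + N ℤ.+ + 1 ℤ.- + 3 ℤ.* + n ℤ.- + m → binom★ p k (+ m) ≡ 0ˢ
binom★-vanishes p N m       n -[1+ 0 ]     out k≤ with upper-entry-negative N m n (+ 1) out k≤
... | ℤ.+<+ ()
binom★-vanishes p N m       n -[1+ suc k ] out k≤ = refl
binom★-vanishes p N m       n (+ k)        out k≤ with upper-entry-negative N m n (+ k ℤ.+ + 2) out k≤
... | ℤ.+<+ ()

⌊⅔_⌋ : ℤ → ℤ
⌊⅔ x ⌋ = floor ((+ 2 / 3) ℚᵘ.* (x / 1))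

∑∑ : (B : ℕ) → (ℕ → ℕ → Series) → Series
∑∑ B f d = ∑ {suc B} (λ m → ∑ {suc B} (λ n → f (toℕ m) (toℕ n) d))

-- A sum over all m, n ≥ 0 whose (m , n) term vanishes as soon as m > N + 1 or n > N + 1.
-- This is so for every sum considered: its first Gaussian coefficient has lower entry m and
-- upper entry at most N + 1 - 3n - m (at most N - 1 - 3n - m for the starred one), so
-- binom-vanishes and binom★-vanishes apply.
∑ₘₙ : (N : ℕ) → (ℕ → ℕ → Series) → Series
∑ₘₙ N = ∑∑ (suc N)

Q : ℕ → ℕ → ℕ
Q m n = m ℕ.* m ℕ.+ 3 ℕ.* m ℕ.* n ℕ.+ 3 ℕ.* n ℕ.* n

S₂₃ S₃₆ S₀₋₁ S₃₅ S₁₃ S₀₂ : ℕ → Series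

S₂₃ N = ∑ₘₙ N λ m n →
  q ^ˢ (Q m n ℕ.+ 2 ℕ.* m ℕ.+ 3 ℕ.* n)
    *ˢ binom★ q (+ N ℤ.- + 3 ℤ.* + n ℤ.- + m ℤ.- + 1) (+ m)
    *ˢ binom (q ^ˢ 3) (⌊⅔ + N ⌋ ℤ.- + m ℤ.- + n) (+ n)

S₃₆ N = ∑ₘₙ N λ m n →
  q ^ˢ (Q m n ℕ.+ 3 ℕ.* m ℕ.+ 6 ℕ.* n)
    *ˢ binom q (+ N ℤ.- + 3 ℤ.* + n ℤ.- + m ℤ.- + 2) (+ m)
    *ˢ binom (q ^ˢ 3) (⌊⅔ + N ⌋ ℤ.- + 1 ℤ.- + m ℤ.- + n) (+ n)

-- The truncated subtraction in the exponent is exact, since n ≤ 3n² ≤ Q m n.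
S₀₋₁ N = ∑ₘₙ N λ m n →
  q ^ˢ (Q m n ∸ n)
    *ˢ binom q (+ N ℤ.+ + 1 ℤ.- + 3 ℤ.* + n ℤ.- + m) (+ m)
    *ˢ binom (q ^ˢ 3) (⌊⅔ + N ℤ.+ + 2 ⌋ ℤ.- + m ℤ.- + n) (+ n)

S₃₅ N = ∑ₘₙ N λ m n →
  q ^ˢ (Q m n ℕ.+ 3 ℕ.* m ℕ.+ 5 ℕ.* n)
    *ˢ binom q (+ N ℤ.- + 3 ℤ.* + n ℤ.- + m ℤ.- + 2) (+ m)
    *ˢ binom (q ^ˢ 3) (⌊⅔ + N ℤ.- + 1 ⌋ ℤ.- + m ℤ.- + n) (+ n)

S₁₃ N = S₂₃ N +ˢ q ^ˢ 2 *ˢ S₃₆ N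

S₀₂ N = S₀₋₁ N -ˢ q ^ˢ 2 *ˢ S₃₅ N

{-# OPTIONS --safe #-}
module Submission where

-- Both identities come from the q-Pascal recurrence (pascal)
--   [k; l+1]_p = p^(l+1) [k-1; l+1]_p + [k-1; l]_p,
-- applied to every summand of one double sum.
--
-- For S(1,3), start from the right-hand side and expand the coefficient [N-m-3n; m] with
-- p = q. The first part has q^m [N-m-3n-1; m] and is the summand of S(2,3). In the second
-- part, m becomes m + 1; the entries are then those of S(3,6), and the exponent of q is 2
-- more than there. At m = 0 the recurrence is not used: there the claim is
-- [k; 0] = [k-1; 0]★, and the star is what makes this true at k = 0.
--
-- For S(0,2), start from S(0,-1) and expand the coefficient [K; n] with p = q³, where
-- K = M + 2 - m - n, with M the floor of 2(N-1)/3 and hence M + 2 that of 2(N+2)/3. The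
-- first part has q^(3n) [K-1; n] and is the summand of the right-hand side; the second one,
-- after n becomes n + 1, is q² times the summand of S(3,5). At n = 0 the claim needed is
-- [K; 0] = [K-1; 0], which fails only for K = 0. Then m = M + 2 and N + 1 < 2m
-- (⌊⅔⌋-lower), so that [N+1-m; m] = 0 and the summand vanishes on both sides.
--
-- Shifting a summation variable in a sum truncated at N + 1 costs the summand of S(3,6) or
-- S(3,5) at N + 1, which is zero (upper-negative).
--
-- The recurrence itself holds because a Gaussian coefficient is the unique series whose
-- product with (p;p)_l (p;p)_(k-l) is (p;p)_k (binom-unique): the factor (p;p)_l (p;p)_(k-l)
-- has constant term 1, hence can be cancelled. After multiplication the recurrence reduces
-- to x (1 - y) + (1 - x) = 1 - x y (P-factors).

open import Defs
open import Data.Integer.Base as ℤ using (+_)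
open import Data.Nat.Base as ℕ using (ℕ)
open import Data.Product.Base using (_×_)

open import Algebra.Bundles using (CommutativeSemiring)
open import Algebra.Structures.Biased using (IsCommutativeSemiringˡ)
import Algebra.Properties.Semiring.Sum
import Algebra.Solver.Ring.NaturalCoefficients.Default
open import Data.Bool.Base using (true; false)
open import Data.Empty using (⊥-elim)
open import Data.Fin.Base as Fin using (Fin; toℕ; fromℕ; inject₁)
open import Data.Fin.Properties using (toℕ-inject₁; toℕ-fromℕ)
open import Data.Integer.Base using (ℤ; -[1+_]; 0ℤ; 1ℤ)
import Data.Integer.Properties as ℤ
import Data.Integer.Tactic.RingSolver as ℤ-Solver
open import Data.Nat.Base using (zero; suc; _∸_)
open import Data.Nat.Divisibility using (divides)
import Data.Nat.DivMod as ℕ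
import Data.Nat.Properties as ℕ
import Data.Nat.Tactic.RingSolver as ℕ-Solver
open import Data.Product.Base using (_,_)
open import Level using (0ℓ)
open import Relation.Binary.PropositionalEquality
open import Relation.Binary.Structures using (IsEquivalence)
open import Relation.Nullary.Decidable.Core using (yes; no)

-- The semiring of power series

-- f = f 0 + q · tail f.  Convolution satisfies, by computation,
-- (f *ˢ g) (suc d) = f 0 · g (suc d) + (tail f *ˢ g) d, so that the semiring laws
-- follow by induction on the degree.
tail : Series → Series
tail f d = f (suc d)

-- Multiplication by a scalar.
infixr 7 _·_

_·_ : ℤ → Series → Series
(c · f) d = c ℤ.* f d

*ˢ-cong : ∀ {f f′ g g′} → f ≈ f′ → g ≈ g′ → f *ˢ g ≈ f′ *ˢ g′
*ˢ-cong p r zero    = cong₂ (λ x y → x ℤ.* y ℤ.+ 0ℤ) (p 0) (r 0)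
*ˢ-cong p r (suc d) = cong₂ ℤ._+_ (cong₂ ℤ._*_ (p 0) (r (suc d))) (*ˢ-cong (λ e → p (suc e)) r d)

private
  zip-add : ∀ a b x y z → (a ℤ.+ b) ℤ.* x ℤ.+ (y ℤ.+ z) ≡ (a ℤ.* x ℤ.+ y) ℤ.+ (b ℤ.* x ℤ.+ z)
  zip-add = ℤ-Solver.solve-∀

  factor : ∀ c a x y → (c ℤ.* a) ℤ.* x ℤ.+ c ℤ.* y ≡ c ℤ.* (a ℤ.* x ℤ.+ y)
  factor = ℤ-Solver.solve-∀

  factor₃ : ∀ a b x y z → (a ℤ.* b) ℤ.* x ℤ.+ (a ℤ.* y ℤ.+ z) ≡ a ℤ.* (b ℤ.* x ℤ.+ y) ℤ.+ z
  factor₃ = ℤ-Solver.solve-∀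

*ˢ-distribʳ : ∀ h f g → (f +ˢ g) *ˢ h ≈ f *ˢ h +ˢ g *ˢ h
*ˢ-distribʳ h f g zero    = zip-add (f 0) (g 0) (h 0) 0ℤ 0ℤ
*ˢ-distribʳ h f g (suc d) = trans
  (cong (λ z → (f 0 ℤ.+ g 0) ℤ.* h (suc d) ℤ.+ z) (*ˢ-distribʳ h (tail f) (tail g) d))
  (zip-add (f 0) (g 0) (h (suc d)) ((tail f *ˢ h) d) ((tail g *ˢ h) d))

·-*ˢ : ∀ c f g → (c · f) *ˢ g ≈ c · (f *ˢ g)
·-*ˢ c f g zero    = trans (cong (λ z → (c ℤ.* f 0) ℤ.* g 0 ℤ.+ z) (sym (ℤ.*-zeroʳ c)))
                           (factor c (f 0) (g 0) 0ℤ)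
·-*ˢ c f g (suc d) = trans
  (cong (λ z → (c ℤ.* f 0) ℤ.* g (suc d) ℤ.+ z) (·-*ˢ c (tail f) g d))
  (factor c (f 0) (g (suc d)) ((tail f *ˢ g) d))

*ˢ-zeroˡ : ∀ g → 0ˢ *ˢ g ≈ 0ˢ
*ˢ-zeroˡ g zero    = refl
*ˢ-zeroˡ g (suc d) = trans (ℤ.+-identityˡ _) (*ˢ-zeroˡ g d)

*ˢ-identityˡ : ∀ g → 1ˢ *ˢ g ≈ g
*ˢ-identityˡ g zero    = trans (ℤ.+-identityʳ _) (ℤ.*-identityˡ (g 0))
*ˢ-identityˡ g (suc d) =
  trans (cong₂ ℤ._+_ (ℤ.*-identityˡ (g (suc d))) (*ˢ-zeroˡ g d)) (ℤ.+-identityʳ _)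

*ˢ-assoc : ∀ f g h → (f *ˢ g) *ˢ h ≈ f *ˢ (g *ˢ h)
*ˢ-assoc f g h zero    = simplify (f 0) (g 0) (h 0)
  where
  simplify : ∀ a b c → (a ℤ.* b ℤ.+ 0ℤ) ℤ.* c ℤ.+ 0ℤ ≡ a ℤ.* (b ℤ.* c ℤ.+ 0ℤ) ℤ.+ 0ℤ
  simplify = ℤ-Solver.solve-∀
*ˢ-assoc f g h (suc d) = begin
  (f 0 ℤ.* g 0 ℤ.+ 0ℤ) ℤ.* h (suc d) ℤ.+ ((f 0 · tail g +ˢ tail f *ˢ g) *ˢ h) d
    ≡⟨ cong₂ (λ x y → x ℤ.* h (suc d) ℤ.+ y) (ℤ.+-identityʳ (f 0 ℤ.* g 0))
             (*ˢ-distribʳ h (f 0 · tail g) (tail f *ˢ g) d) ⟩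
  (f 0 ℤ.* g 0) ℤ.* h (suc d) ℤ.+ (((f 0 · tail g) *ˢ h) d ℤ.+ ((tail f *ˢ g) *ˢ h) d)
    ≡⟨ cong₂ (λ x y → (f 0 ℤ.* g 0) ℤ.* h (suc d) ℤ.+ (x ℤ.+ y))
             (·-*ˢ (f 0) (tail g) h d) (*ˢ-assoc (tail f) g h d) ⟩
  (f 0 ℤ.* g 0) ℤ.* h (suc d) ℤ.+ (f 0 ℤ.* (tail g *ˢ h) d ℤ.+ (tail f *ˢ (g *ˢ h)) d)
    ≡⟨ factor₃ (f 0) (g 0) (h (suc d)) ((tail g *ˢ h) d) ((tail f *ˢ (g *ˢ h)) d) ⟩
  f 0 ℤ.* (g *ˢ h) (suc d) ℤ.+ (tail f *ˢ (g *ˢ h)) d ∎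
  where open ≡-Reasoning

-- The mirror image of the recursion of convolution: the last term is split off
-- instead of the first. Commutativity follows by comparing the two.
*ˢ-suc : ∀ f g d → (f *ˢ g) (suc d) ≡ (f *ˢ tail g) d ℤ.+ f (suc d) ℤ.* g 0
*ˢ-suc f g zero    = arrange (f 0 ℤ.* g 1) (f 1 ℤ.* g 0)
  where
  arrange : ∀ x y → x ℤ.+ (y ℤ.+ 0ℤ) ≡ (x ℤ.+ 0ℤ) ℤ.+ y
  arrange = ℤ-Solver.solve-∀
*ˢ-suc f g (suc d) = trans
  (cong (λ z → f 0 ℤ.* g (suc (suc d)) ℤ.+ z) (*ˢ-suc (tail f) g d))
  (sym (ℤ.+-assoc (f 0 ℤ.* g (suc (suc d))) ((tail f *ˢ tail g) d) (f (suc (suc d)) ℤ.* g 0)))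

*ˢ-comm : ∀ f g → f *ˢ g ≈ g *ˢ f
*ˢ-comm f g zero    = cong (ℤ._+ 0ℤ) (ℤ.*-comm (f 0) (g 0))
*ˢ-comm f g (suc d) = begin
  f 0 ℤ.* g (suc d) ℤ.+ (tail f *ˢ g) d  ≡⟨ cong₂ ℤ._+_ (ℤ.*-comm (f 0) (g (suc d))) (*ˢ-comm (tail f) g d) ⟩
  g (suc d) ℤ.* f 0 ℤ.+ (g *ˢ tail f) d  ≡⟨ ℤ.+-comm _ ((g *ˢ tail f) d) ⟩
  (g *ˢ tail f) d ℤ.+ g (suc d) ℤ.* f 0  ≡⟨ *ˢ-suc g f d ⟨
  (g *ˢ f) (suc d)                       ∎
  where open ≡-Reasoning

-- ℤ[[q]] as a commutative semiring. Subtraction is left out: it occurs only in the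
-- factors 1 - p^(n+1) and in S₀₂, and is handled there coefficientwise.
series : CommutativeSemiring 0ℓ 0ℓ
series = record
  { Carrier = Series ; _≈_ = _≈_ ; _+_ = _+ˢ_ ; _*_ = _*ˢ_ ; 0# = 0ˢ ; 1# = 1ˢ
  ; isCommutativeSemiring = IsCommutativeSemiringˡ.isCommutativeSemiring record
    { +-isCommutativeMonoid = record
      { isMonoid = record
        { isSemigroup = record
          { isMagma = record
            { isEquivalence = isEq
            ; ∙-cong = λ p r d → cong₂ ℤ._+_ (p d) (r d) }
          ; assoc = λ f g h d → ℤ.+-assoc (f d) (g d) (h d) }
        ; identity = (λ f d → ℤ.+-identityˡ (f d)) , (λ f d → ℤ.+-identityʳ (f d)) }
      ; comm = λ f g d → ℤ.+-comm (f d) (g d) }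
    ; *-isCommutativeMonoid = record
      { isMonoid = record
        { isSemigroup = record
          { isMagma = record { isEquivalence = isEq ; ∙-cong = *ˢ-cong }
          ; assoc = *ˢ-assoc }
        ; identity = *ˢ-identityˡ , λ f d → trans (*ˢ-comm f 1ˢ d) (*ˢ-identityˡ f d) }
      ; comm = *ˢ-comm }
    ; distribʳ = *ˢ-distribʳ
    ; zeroˡ    = *ˢ-zeroˡ
    }
  }
  where
  isEq : IsEquivalence _≈_
  isEq = record
    { refl = λ _ → refl ; sym = λ p d → sym (p d) ; trans = λ p r d → trans (p d) (r d) }

private module Sum = Algebra.Properties.Semiring.Sum ℤ.+-*-semiring
module S = CommutativeSemiring series
open Algebra.Solver.Ring.NaturalCoefficients.Default series
  using (solve; _:=_; _:+_; _:*_)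
import Relation.Binary.Reasoning.Setoid S.setoid as ≈-Reasoning

-- Cancellation of a factor with constant term 1

÷ˢ-congˡ : ∀ {f f′} g → f ≈ f′ → f ÷ˢ g ≈ f′ ÷ˢ g
÷ˢ-congˡ g p zero    = p 0
÷ˢ-congˡ g p (suc d) =
  ÷ˢ-congˡ g (λ e → cong₂ (λ x y → x ℤ.- y ℤ.* g (suc e)) (p (suc e)) (p 0)) d

-- Long division undoes multiplication, since its first remainder is tail f *ˢ g.
*ˢ-÷ˢ : ∀ f g → g 0 ≡ 1ℤ → (f *ˢ g) ÷ˢ g ≈ f
*ˢ-÷ˢ f g g₀≡1 zero    =
  trans (ℤ.+-identityʳ _) (trans (cong (f 0 ℤ.*_) g₀≡1) (ℤ.*-identityʳ (f 0)))
*ˢ-÷ˢ f g g₀≡1 (suc d) = trans (÷ˢ-congˡ g remainder d) (*ˢ-÷ˢ (tail f) g g₀≡1 d)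
  where
  cancel : ∀ a x y → a ℤ.* x ℤ.+ y ℤ.- (a ℤ.* 1ℤ ℤ.+ 0ℤ) ℤ.* x ≡ y
  cancel = ℤ-Solver.solve-∀
  remainder : (λ e → (f *ˢ g) (suc e) ℤ.- (f *ˢ g) 0 ℤ.* g (suc e)) ≈ tail f *ˢ g
  remainder e = trans
    (cong (λ z → (f *ˢ g) (suc e) ℤ.- (f 0 ℤ.* z ℤ.+ 0ℤ) ℤ.* g (suc e)) g₀≡1)
    (cancel (f 0) (g (suc e)) ((tail f *ˢ g) e))

*ˢ-cancelʳ : ∀ f h g → g 0 ≡ 1ℤ → f *ˢ g ≈ h *ˢ g → f ≈ h
*ˢ-cancelʳ f h g g₀≡1 p d =
  trans (sym (*ˢ-÷ˢ f g g₀≡1 d)) (trans (÷ˢ-congˡ g p d) (*ˢ-÷ˢ h g g₀≡1 d))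

-- Powers

^ˢ-+ : ∀ f a b → f ^ˢ (a ℕ.+ b) ≈ f ^ˢ a *ˢ f ^ˢ b
^ˢ-+ f zero    b = S.sym (S.*-identityˡ (f ^ˢ b))
^ˢ-+ f (suc a) b = begin
  f ^ˢ (a ℕ.+ b) *ˢ f        ≈⟨ S.*-congʳ (^ˢ-+ f a b) ⟩
  (f ^ˢ a *ˢ f ^ˢ b) *ˢ f    ≈⟨ solve 3 (λ x y z → (x :* y) :* z := (x :* z) :* y) S.refl (f ^ˢ a) (f ^ˢ b) f ⟩
  (f ^ˢ a *ˢ f) *ˢ f ^ˢ b    ∎
  where open ≈-Reasoning

^ˢ-* : ∀ f a b → (f ^ˢ a) ^ˢ b ≈ f ^ˢ (b ℕ.* a)
^ˢ-* f a zero    = S.refl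
^ˢ-* f a (suc b) = begin
  (f ^ˢ a) ^ˢ b *ˢ f ^ˢ a    ≈⟨ S.*-congʳ (^ˢ-* f a b) ⟩
  f ^ˢ (b ℕ.* a) *ˢ f ^ˢ a   ≈⟨ S.*-comm (f ^ˢ (b ℕ.* a)) (f ^ˢ a) ⟩
  f ^ˢ a *ˢ f ^ˢ (b ℕ.* a)   ≈⟨ ^ˢ-+ f a (b ℕ.* a) ⟨
  f ^ˢ (a ℕ.+ b ℕ.* a)       ∎
  where open ≈-Reasoning

-- Gaussian coefficients

binom-< : ∀ p {k l} → k ℕ.< l → binom p (+ k) (+ l) ≡ 0ˢ
binom-< p {k} {l} k<l with l ℕ.≤ᵇ k | ℕ.≤ᵇ⇒≤ l k
... | false | _   = refl
... | true  | l≤k = ⊥-elim (ℕ.<⇒≱ k<l (l≤k _))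

-- The recurrence for a base p without constant term.
module _ (p : Series) (p₀≡0 : p 0 ≡ 0ℤ) where

  private
    P : ℕ → Series
    P = pochhammer p p

    P*P-const : ∀ l j → (P l *ˢ P j) 0 ≡ 1ℤ
    P*P-const l j = trans (ℤ.+-identityʳ _)
      (cong₂ ℤ._*_ (pochhammer-const p l p₀≡0) (pochhammer-const p j p₀≡0))

  -- The defining quotient with upper entry l + j, cleared of its denominator.
  binom-P : ∀ l j → binom p (+ (l ℕ.+ j)) (+ l) *ˢ (P l *ˢ P j) ≈ P (l ℕ.+ j)
  binom-P l j = subst (λ i → binom p (+ (l ℕ.+ j)) (+ l) *ˢ (P l *ˢ P i) ≈ P (l ℕ.+ j))
    (ℕ.m+n∸m≡n l j) (binom-quotient p p₀≡0 (ℕ.m≤m+n l j))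

  -- A Gaussian coefficient is the only series with the property binom-P.
  binom-unique : ∀ l j f → f *ˢ (P l *ˢ P j) ≈ P (l ℕ.+ j) → f ≈ binom p (+ (l ℕ.+ j)) (+ l)
  binom-unique l j f eq =
    *ˢ-cancelʳ f _ (P l *ˢ P j) (P*P-const l j) (S.trans eq (S.sym (binom-P l j)))

  binom-k-0 : ∀ k → binom p (+ k) (+ 0) ≈ 1ˢ
  binom-k-0 k = S.sym (binom-unique 0 k 1ˢ
    (S.trans (S.*-identityˡ _) (S.*-identityˡ _)))

  binom-k-k : ∀ k → binom p (+ k) (+ k) ≈ 1ˢ
  binom-k-k k = subst (λ i → binom p (+ i) (+ k) ≈ 1ˢ) (ℕ.+-identityʳ k)
    (S.sym (binom-unique k 0 1ˢ (begin
      1ˢ *ˢ (P k *ˢ 1ˢ)  ≈⟨ S.*-identityˡ _ ⟩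
      P k *ˢ 1ˢ          ≈⟨ S.*-identityʳ _ ⟩
      P k                ≡⟨ cong P (ℕ.+-identityʳ k) ⟨
      P (k ℕ.+ 0)        ∎)))
    where open ≈-Reasoning

  -- The identity x (1 - y) + (1 - x) = 1 - x y, with x = p^(l+1) and y = p^(j+1)
  P-factors : ∀ l j →
    p ^ˢ suc l *ˢ (1ˢ -ˢ p ^ˢ j *ˢ p) +ˢ (1ˢ -ˢ p ^ˢ l *ˢ p) ≈ 1ˢ -ˢ p ^ˢ (l ℕ.+ suc j) *ˢ p
  P-factors l j = begin
    x *ˢ (1ˢ -ˢ y) +ˢ (1ˢ -ˢ x)      ≈⟨ S.+-congʳ split ⟩
    (x -ˢ x *ˢ y) +ˢ (1ˢ -ˢ x)       ≈⟨ (λ d → telescope (x d) ((x *ˢ y) d) (1ˢ d)) ⟩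
    1ˢ -ˢ x *ˢ y                     ≈⟨ (λ d → cong (λ z → 1ˢ d ℤ.- z) (product d)) ⟩
    1ˢ -ˢ p ^ˢ (l ℕ.+ suc j) *ˢ p    ∎
    where
    open ≈-Reasoning
    x y : Series
    x = p ^ˢ suc l
    y = p ^ˢ suc j
    telescope : ∀ a b c → (a ℤ.- b) ℤ.+ (c ℤ.- a) ≡ c ℤ.- b
    telescope = ℤ-Solver.solve-∀
    subtract : ∀ a b c → a ℤ.+ b ≡ c → a ≡ c ℤ.- b
    subtract a b c eq = trans (sym (ℤ.+-identityʳ a)) (trans (cong (λ z → a ℤ.+ z) (sym (ℤ.+-inverseʳ b)))
      (trans (sym (ℤ.+-assoc a b (ℤ.- b))) (cong (ℤ._- b) eq)))
    restore : ∀ a b → (a ℤ.- b) ℤ.+ b ≡ a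
    restore = ℤ-Solver.solve-∀
    split : x *ˢ (1ˢ -ˢ y) ≈ x -ˢ x *ˢ y
    split d = subtract _ _ _ (
      S.trans (S.sym (S.distribˡ x (1ˢ -ˢ y) y))
      (S.trans (S.*-congˡ {x} (λ e → restore (1ˢ e) (y e))) (S.*-identityʳ x)) d)
    product : x *ˢ y ≈ p ^ˢ (l ℕ.+ suc j) *ˢ p
    product = S.trans
      (solve 3 (λ a b c → (a :* c) :* (b :* c) := (a :* (b :* c)) :* c) S.refl (p ^ˢ l) (p ^ˢ j) p)
      (S.*-congʳ (S.sym (^ˢ-+ p l (suc j))))

  pascal-ℕ : ∀ k l → binom p (+ suc k) (+ suc l) ≈
    p ^ˢ suc l *ˢ binom p (+ k) (+ suc l) +ˢ binom p (+ k) (+ l)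
  pascal-ℕ k l with ℕ.compare k l
  -- k < l: all three coefficients vanish.
  ... | ℕ.less .k j = begin
    binom p (+ suc k) (+ suc l)                      ≡⟨ binom-< p (ℕ.s≤s k<l) ⟩
    0ˢ                                               ≈⟨ S.zeroʳ (p ^ˢ suc l) ⟨
    p ^ˢ suc l *ˢ 0ˢ                                 ≈⟨ S.+-identityʳ _ ⟨
    p ^ˢ suc l *ˢ 0ˢ +ˢ 0ˢ                           ≡⟨ cong₂ (λ x y → p ^ˢ suc l *ˢ x +ˢ y) (binom-< p (ℕ.m≤n⇒m≤1+n k<l)) (binom-< p k<l) ⟨
    p ^ˢ suc l *ˢ binom p (+ k) (+ suc l) +ˢ binom p (+ k) (+ l) ∎
    where
    open ≈-Reasoning
    k<l : k ℕ.< suc (k ℕ.+ j)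
    k<l = ℕ.s≤s (ℕ.m≤m+n k j)
  -- k = l: the recurrence reads 1 = 0 + 1.
  ... | ℕ.equal .k = begin
    binom p (+ suc k) (+ suc k)                      ≈⟨ binom-k-k (suc k) ⟩
    1ˢ                                               ≈⟨ binom-k-k k ⟨
    binom p (+ k) (+ k)                              ≈⟨ S.+-identityˡ _ ⟨
    0ˢ +ˢ binom p (+ k) (+ k)                        ≈⟨ S.+-congʳ (S.zeroʳ (p ^ˢ suc k)) ⟨
    p ^ˢ suc k *ˢ 0ˢ +ˢ binom p (+ k) (+ k)          ≡⟨ cong (λ x → p ^ˢ suc k *ˢ x +ˢ binom p (+ k) (+ k)) (binom-< p (ℕ.n<1+n k)) ⟨
    p ^ˢ suc k *ˢ binom p (+ k) (+ suc k) +ˢ binom p (+ k) (+ k) ∎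
    where open ≈-Reasoning
  -- k = l + 1 + j: multiply by (p;p)_(l+1) (p;p)_(j+1).
  ... | ℕ.greater .l j =
    S.sym (subst (λ i → x *ˢ b +ˢ c ≈ binom p (+ i) (+ suc l)) (ℕ.+-suc (suc l) j)
      (binom-unique (suc l) (suc j) (x *ˢ b +ˢ c) (begin
        (x *ˢ b +ˢ c) *ˢ ((P l *ˢ u) *ˢ (P j *ˢ v))
          ≈⟨ solve 7 (λ x b c a u a′ v → (x :* b :+ c) :* ((a :* u) :* (a′ :* v))
                := (b :* ((a :* u) :* a′)) :* (x :* v) :+ (c :* (a :* (a′ :* v))) :* u)
               S.refl x b c (P l) u (P j) v ⟩
        (b *ˢ (P (suc l) *ˢ P j)) *ˢ (x *ˢ v) +ˢ (c *ˢ (P l *ˢ P (suc j))) *ˢ u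
          ≈⟨ S.+-cong (S.*-congʳ (binom-P (suc l) j)) (S.*-congʳ c-P) ⟩
        P k *ˢ (x *ˢ v) +ˢ P k *ˢ u
          ≈⟨ S.distribˡ (P k) (x *ˢ v) u ⟨
        P k *ˢ (x *ˢ v +ˢ u)
          ≡⟨ cong (λ i → P i *ˢ (x *ˢ v +ˢ u)) (ℕ.+-suc l j) ⟨
        P (l ℕ.+ suc j) *ˢ (x *ˢ v +ˢ u)
          ≈⟨ S.*-congˡ {P (l ℕ.+ suc j)} (P-factors l j) ⟩
        P (suc l ℕ.+ suc j) ∎)))
    where
    open ≈-Reasoning
    x b c u v : Series
    x = p ^ˢ suc l
    b = binom p (+ k) (+ suc l)
    c = binom p (+ k) (+ l)
    u = 1ˢ -ˢ p ^ˢ l *ˢ p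
    v = 1ˢ -ˢ p ^ˢ j *ˢ p
    c-P : c *ˢ (P l *ˢ P (suc j)) ≈ P k
    c-P = subst (λ i → binom p (+ i) (+ l) *ˢ (P l *ˢ P (suc j)) ≈ P i) (ℕ.+-suc l j)
      (binom-P l (suc j))

  -- For a positive lower entry the recurrence holds for every upper entry, even a
  -- negative one; for lower entry 0 it would fail at upper entry 0.
  pascal : ∀ k l → binom p k (+ suc l) ≈
    p ^ˢ suc l *ˢ binom p (k ℤ.- 1ℤ) (+ suc l) +ˢ binom p (k ℤ.- 1ℤ) (+ l)
  pascal (+ suc k) l = pascal-ℕ k l
  pascal (+ zero)  l = S.sym (S.trans (S.+-identityʳ _) (S.zeroʳ (p ^ˢ suc l)))
  pascal -[1+ k ]  l = S.sym (S.trans (S.+-identityʳ _) (S.zeroʳ (p ^ˢ suc l)))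

  binom-pred-0 : ∀ k → k ≢ 0ℤ → binom p k (+ 0) ≈ binom p (k ℤ.- 1ℤ) (+ 0)
  binom-pred-0 (+ zero)  k≢0 = ⊥-elim (k≢0 refl)
  binom-pred-0 (+ suc k) k≢0 = S.trans (binom-k-0 (suc k)) (S.sym (binom-k-0 k))
  binom-pred-0 -[1+ k ]  k≢0 = S.refl

  -- With the starred coefficient the exceptional case k = 0 disappears.
  binom★-pred-0 : ∀ k → binom p k (+ 0) ≈ binom★ p (k ℤ.- 1ℤ) (+ 0)
  binom★-pred-0 (+ zero)  = binom-k-0 0
  binom★-pred-0 (+ suc k) = S.trans (binom-k-0 (suc k)) (S.sym (binom-k-0 k))
  binom★-pred-0 -[1+ k ]  = S.refl

binom★-suc : ∀ p k l → binom★ p k (+ suc l) ≡ binom p k (+ suc l)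
binom★-suc p (+ k)        l = refl
binom★-suc p -[1+ zero ]  l = refl
binom★-suc p -[1+ suc k ] l = refl

binom-below : ∀ p {k l} → k ℤ.< + l → binom p k (+ l) ≡ 0ˢ
binom-below p { -[1+ _ ]} _             = refl
binom-below p {+ k}       (ℤ.+<+ k<l) = binom-< p k<l

-- Double sums

-- Each t i is a i plus the preceding c (i - 1); summing up to n leaves out c n.
∑-shift : ∀ (t a c : ℕ → ℤ) → t 0 ≡ a 0 → (∀ i → t (suc i) ≡ a (suc i) ℤ.+ c i) →
  ∀ n → c n ≡ 0ℤ →
  ∑ {suc n} (λ i → t (toℕ i)) ≡ ∑ {suc n} (λ i → a (toℕ i)) ℤ.+ ∑ {suc n} (λ i → c (toℕ i))
∑-shift t a c t₀ t₊ n cₙ≡0 = begin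
  t 0 ℤ.+ ∑ {n} (λ i → t (suc (toℕ i)))
    ≡⟨ cong₂ ℤ._+_ t₀ (Sum.sum-cong-≗ {n} (λ i → t₊ (toℕ i))) ⟩
  a 0 ℤ.+ ∑ {n} (λ i → a (suc (toℕ i)) ℤ.+ c (toℕ i))
    ≡⟨ cong (λ z → a 0 ℤ.+ z) (Sum.∑-distrib-+ {n} (λ i → a (suc (toℕ i))) (λ i → c (toℕ i))) ⟩
  a 0 ℤ.+ (∑ {n} (λ i → a (suc (toℕ i))) ℤ.+ ∑ {n} (λ i → c (toℕ i)))
    ≡⟨ ℤ.+-assoc (a 0) _ _ ⟨
  ∑ {suc n} (λ i → a (toℕ i)) ℤ.+ ∑ {n} (λ i → c (toℕ i))
    ≡⟨ cong (λ z → ∑ {suc n} (λ i → a (toℕ i)) ℤ.+ z) last-zero ⟨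
  ∑ {suc n} (λ i → a (toℕ i)) ℤ.+ ∑ {suc n} (λ i → c (toℕ i)) ∎
  where
  open ≡-Reasoning
  last-zero : ∑ {suc n} (λ i → c (toℕ i)) ≡ ∑ {n} (λ i → c (toℕ i))
  last-zero = begin
    ∑ {suc n} (λ i → c (toℕ i))
      ≡⟨ Sum.sum-init-last {n} (λ i → c (toℕ i)) ⟩
    ∑ {n} (λ i → c (toℕ (inject₁ i))) ℤ.+ c (toℕ (fromℕ n))
      ≡⟨ cong₂ ℤ._+_ (Sum.sum-cong-≗ {n} (λ i → cong c (toℕ-inject₁ i)))
                     (trans (cong c (toℕ-fromℕ n)) cₙ≡0) ⟩
    ∑ {n} (λ i → c (toℕ i)) ℤ.+ 0ℤ
      ≡⟨ ℤ.+-identityʳ _ ⟩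
    ∑ {n} (λ i → c (toℕ i)) ∎

module _ (T A C : ℕ → ℕ → Series) (B : ℕ) where

  private
    -- The inner sum over n, for fixed m.
    row : (ℕ → ℕ → Series) → ℕ → Series
    row F m d = ∑ {suc B} (λ n → F m (toℕ n) d)

  -- The same for a double sum, in its first or in its second summation variable.
  ∑∑-shiftˡ : (∀ n → T 0 n ≈ A 0 n) → (∀ m n → T (suc m) n ≈ A (suc m) n +ˢ C m n) →
    (∀ n → C B n ≈ 0ˢ) → ∑∑ B T ≈ ∑∑ B A +ˢ ∑∑ B C
  ∑∑-shiftˡ T₀ T₊ C₀ d = ∑-shift (λ m → row T m d) (λ m → row A m d) (λ m → row C m d)
    (Sum.sum-cong-≗ {suc B} (λ n → T₀ (toℕ n) d))
    (λ m → trans (Sum.sum-cong-≗ {suc B} (λ n → T₊ m (toℕ n) d))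
      (Sum.∑-distrib-+ {suc B} (λ n → A (suc m) (toℕ n) d) (λ n → C m (toℕ n) d)))
    B
    (trans (Sum.sum-cong-≗ {suc B} (λ n → C₀ (toℕ n) d)) (Sum.sum-replicate-zero (suc B)))

  ∑∑-shiftʳ : (∀ m → T m 0 ≈ A m 0) → (∀ m n → T m (suc n) ≈ A m (suc n) +ˢ C m n) →
    (∀ m → C m B ≈ 0ˢ) → ∑∑ B T ≈ ∑∑ B A +ˢ ∑∑ B C
  ∑∑-shiftʳ T₀ T₊ C₀ d = trans
    (Sum.sum-cong-≗ {suc B} (λ m → ∑-shift
      (λ n → T (toℕ m) n d) (λ n → A (toℕ m) n d) (λ n → C (toℕ m) n d)
      (T₀ (toℕ m) d) (λ n → T₊ (toℕ m) n d) B (C₀ (toℕ m) d)))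
    (Sum.∑-distrib-+ {suc B} (λ m → row A (toℕ m) d) (λ m → row C (toℕ m) d))

*ˢ-∑ : ∀ f n (g : Fin n → Series) → f *ˢ (λ d → ∑ {n} (λ i → g i d)) ≈ λ d → ∑ {n} (λ i → (f *ˢ g i) d)
*ˢ-∑ f zero    g = S.zeroʳ f
*ˢ-∑ f (suc n) g = S.trans
  (S.distribˡ f (g Fin.zero) (λ d → ∑ {n} (λ i → g (Fin.suc i) d)))
  (S.+-congˡ {(f *ˢ g Fin.zero)} (*ˢ-∑ f n (λ i → g (Fin.suc i))))

*ˢ-∑∑ : ∀ f B F → f *ˢ ∑∑ B F ≈ ∑∑ B (λ m n → f *ˢ F m n)
*ˢ-∑∑ f B F d = trans
  (*ˢ-∑ f (suc B) (λ m d → ∑ {suc B} (λ n → F (toℕ m) (toℕ n) d)) d)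
  (Sum.sum-cong-≗ {suc B} (λ m → *ˢ-∑ f (suc B) (λ n → F (toℕ m) (toℕ n)) d))

-- The floor of 2x/3

⌊⅔⌋-ℕ : ∀ x → ⌊⅔ + x ⌋ ≡ + (2 ℕ.* x ℕ./ 3)
⌊⅔⌋-ℕ x rewrite sym (ℤ.pos-* 2 x) = ℤ.*-identityˡ _

⌊⅔⌋-shift : ∀ N → ⌊⅔ + N ℤ.+ + 2 ⌋ ≡ ⌊⅔ + N ℤ.- + 1 ⌋ ℤ.+ + 2
⌊⅔⌋-shift zero    = refl
⌊⅔⌋-shift (suc n) = begin
  ⌊⅔ + (suc n ℕ.+ 2) ⌋             ≡⟨ ⌊⅔⌋-ℕ (suc n ℕ.+ 2) ⟩
  + (2 ℕ.* (suc n ℕ.+ 2) ℕ./ 3)    ≡⟨ cong (λ z → + (z ℕ./ 3)) (double n) ⟩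
  + ((2 ℕ.* n ℕ.+ 6) ℕ./ 3)        ≡⟨ cong +_ (ℕ.+-distrib-/-∣ʳ (2 ℕ.* n) (divides 2 refl)) ⟩
  + (2 ℕ.* n ℕ./ 3) ℤ.+ + 2        ≡⟨ cong (ℤ._+ + 2) (⌊⅔⌋-ℕ n) ⟨
  ⌊⅔ + n ⌋ ℤ.+ + 2                 ∎
  where
  open ≡-Reasoning
  double : ∀ n → 2 ℕ.* (suc n ℕ.+ 2) ≡ 2 ℕ.* n ℕ.+ 6
  double = ℕ-Solver.solve-∀

-- In other words 2 t > N + 1 for t the floor of 2(N+2)/3: with r ≤ 2 the remainder,
-- 6 t = 4(N+2) - 2 r ≥ 4(N+1) > 3(N+1).
⌊⅔⌋-lower : ∀ N → + N ℤ.+ + 1 ℤ.< ⌊⅔ + N ℤ.+ + 2 ⌋ ℤ.+ ⌊⅔ + N ℤ.+ + 2 ⌋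
⌊⅔⌋-lower N rewrite ⌊⅔⌋-ℕ (N ℕ.+ 2) = ℤ.+<+ (ℕ.*-cancelˡ-< 3 _ _ (begin-strict
  3 ℕ.* (N ℕ.+ 1)                ≤⟨ ℕ.m≤n+m _ N ⟩
  N ℕ.+ 3 ℕ.* (N ℕ.+ 1)          <⟨ ℕ.n<1+n _ ⟩
  suc (N ℕ.+ 3 ℕ.* (N ℕ.+ 1))    ≤⟨ ℕ.+-cancelʳ-≤ 4 _ _ bound ⟩
  3 ℕ.* (t ℕ.+ t)                ∎))
  where
  open ℕ.≤-Reasoning
  t r : ℕ
  t = 2 ℕ.* (N ℕ.+ 2) ℕ./ 3
  r = 2 ℕ.* (N ℕ.+ 2) ℕ.% 3
  r≤2 : r ℕ.≤ 2
  r≤2 = ℕ.s≤s⁻¹ (ℕ.m%n<n (2 ℕ.* (N ℕ.+ 2)) 3)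
  expand : ∀ N → suc (N ℕ.+ 3 ℕ.* (N ℕ.+ 1)) ℕ.+ 4 ≡ 2 ℕ.* (2 ℕ.* (N ℕ.+ 2))
  expand = ℕ-Solver.solve-∀
  collect : ∀ r t → 2 ℕ.* (r ℕ.+ t ℕ.* 3) ≡ 3 ℕ.* (t ℕ.+ t) ℕ.+ 2 ℕ.* r
  collect = ℕ-Solver.solve-∀
  bound : suc (N ℕ.+ 3 ℕ.* (N ℕ.+ 1)) ℕ.+ 4 ℕ.≤ 3 ℕ.* (t ℕ.+ t) ℕ.+ 4
  bound = begin
    suc (N ℕ.+ 3 ℕ.* (N ℕ.+ 1)) ℕ.+ 4  ≡⟨ expand N ⟩
    2 ℕ.* (2 ℕ.* (N ℕ.+ 2))            ≡⟨ cong (2 ℕ.*_) (ℕ.m≡m%n+[m/n]*n (2 ℕ.* (N ℕ.+ 2)) 3) ⟩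
    2 ℕ.* (r ℕ.+ t ℕ.* 3)              ≡⟨ collect r t ⟩
    3 ℕ.* (t ℕ.+ t) ℕ.+ 2 ℕ.* r        ≤⟨ ℕ.+-monoʳ-≤ (3 ℕ.* (t ℕ.+ t)) (ℕ.*-monoʳ-≤ 2 r≤2) ⟩
    3 ℕ.* (t ℕ.+ t) ℕ.+ 4              ∎

-- Splitting a summand

-- A summand q^e b c whose factor b satisfies a recurrence b = q^a x + y. The factor q² is
-- the one in front of S₃₆ and S₃₅.
split-middle : ∀ e e₁ e₂ a {b x y} c → b ≈ q ^ˢ a *ˢ x +ˢ y →
  e ℕ.+ a ≡ e₁ → e ≡ 2 ℕ.+ e₂ →
  q ^ˢ e *ˢ b *ˢ c ≈ q ^ˢ e₁ *ˢ x *ˢ c +ˢ q ^ˢ 2 *ˢ (q ^ˢ e₂ *ˢ y *ˢ c)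
split-middle e _ e₂ a {b} {x} {y} c b≈ refl refl = begin
  q ^ˢ e *ˢ b *ˢ c
    ≈⟨ S.*-congʳ (S.*-congˡ {q ^ˢ e} b≈) ⟩
  q ^ˢ e *ˢ (q ^ˢ a *ˢ x +ˢ y) *ˢ c
    ≈⟨ S.trans (S.*-congʳ (S.distribˡ (q ^ˢ e) (q ^ˢ a *ˢ x) y))
               (S.distribʳ c (q ^ˢ e *ˢ (q ^ˢ a *ˢ x)) (q ^ˢ e *ˢ y)) ⟩
  q ^ˢ e *ˢ (q ^ˢ a *ˢ x) *ˢ c +ˢ q ^ˢ e *ˢ y *ˢ c
    ≈⟨ S.+-cong
        (S.*-congʳ (S.trans (S.sym (S.*-assoc (q ^ˢ e) (q ^ˢ a) x))
                            (S.*-congʳ (S.sym (^ˢ-+ q e a)))))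
        (S.trans (S.*-congʳ (S.trans (S.*-congʳ {y} (^ˢ-+ q 2 e₂))
                                     (S.*-assoc (q ^ˢ 2) (q ^ˢ e₂) y)))
                 (S.*-assoc (q ^ˢ 2) (q ^ˢ e₂ *ˢ y) c)) ⟩
  q ^ˢ (e ℕ.+ a) *ˢ x *ˢ c +ˢ q ^ˢ 2 *ˢ (q ^ˢ e₂ *ˢ y *ˢ c) ∎
  where open ≈-Reasoning

swap-last : ∀ e b c → q ^ˢ e *ˢ b *ˢ c ≈ q ^ˢ e *ˢ c *ˢ b
swap-last e b c = S.trans (S.*-assoc (q ^ˢ e) b c)
  (S.trans (S.*-congˡ {q ^ˢ e} (S.*-comm b c)) (S.sym (S.*-assoc (q ^ˢ e) c b)))

-- The same for a recurrence satisfied by the last factor.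
split-last : ∀ e e₁ e₂ a b {c x y} → c ≈ q ^ˢ a *ˢ x +ˢ y →
  e ℕ.+ a ≡ e₁ → e ≡ 2 ℕ.+ e₂ →
  q ^ˢ e *ˢ b *ˢ c ≈ q ^ˢ e₁ *ˢ b *ˢ x +ˢ q ^ˢ 2 *ˢ (q ^ˢ e₂ *ˢ b *ˢ y)
split-last e e₁ e₂ a b {c} {x} {y} c≈ p₁ p₂ = S.trans (swap-last e b c)
  (S.trans (split-middle e e₁ e₂ a b c≈ p₁ p₂)
    (S.+-cong (swap-last e₁ x b) (S.*-congˡ {q ^ˢ 2} (swap-last e₂ y b))))

-- The two identities

-- At the last index N + 1 of either summation variable the Gaussian coefficient in q
-- that S₃₆ and S₃₅ share has a negative upper entry.
upper-negative : ∀ N m n {l} → N ℕ.< m ℕ.+ n → + N ℤ.- + 3 ℤ.* + n ℤ.- + m ℤ.- + 2 ℤ.< + l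
upper-negative N m n {l} N<m+n = subst (ℤ._< + l) (sym (arrange (+ N) (+ n) (+ m)))
  (ℤ.<-≤-trans (ℤ.+-monoˡ-< (ℤ.- (+ j)) (ℤ.+<+ N<j))
    (ℤ.≤-trans (ℤ.≤-reflexive (ℤ.+-inverseʳ (+ j))) (ℤ.+≤+ ℕ.z≤n)))
  where
  j : ℕ
  j = m ℕ.+ n ℕ.+ (n ℕ.+ n ℕ.+ 2)
  N<j : N ℕ.< j
  N<j = ℕ.≤-trans N<m+n (ℕ.m≤m+n (m ℕ.+ n) _)
  arrange : ∀ N n m → N ℤ.- + 3 ℤ.* n ℤ.- m ℤ.- + 2 ≡ N ℤ.- (m ℤ.+ n ℤ.+ (n ℤ.+ n ℤ.+ + 2))
  arrange = ℤ-Solver.solve-∀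

module _ (N : ℕ) where

  -- The summands of S₂₃, S₃₆, S₀₋₁ and S₃₅, and those of the sums to be shown equal to
  -- S₁₃ and S₀₂.
  term₂₃ term₃₆ term₁₃ term₀₋₁ term₃₅ term₀₂ : ℕ → ℕ → Series
  term₂₃ m n =
    q ^ˢ (Q m n ℕ.+ 2 ℕ.* m ℕ.+ 3 ℕ.* n)
      *ˢ binom★ q (+ N ℤ.- + 3 ℤ.* + n ℤ.- + m ℤ.- + 1) (+ m)
      *ˢ binom (q ^ˢ 3) (⌊⅔ + N ⌋ ℤ.- + m ℤ.- + n) (+ n)
  term₃₆ m n =
    q ^ˢ (Q m n ℕ.+ 3 ℕ.* m ℕ.+ 6 ℕ.* n)
      *ˢ binom q (+ N ℤ.- + 3 ℤ.* + n ℤ.- + m ℤ.- + 2) (+ m)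
      *ˢ binom (q ^ˢ 3) (⌊⅔ + N ⌋ ℤ.- + 1 ℤ.- + m ℤ.- + n) (+ n)
  term₁₃ m n =
    q ^ˢ (Q m n ℕ.+ m ℕ.+ 3 ℕ.* n)
      *ˢ binom q (+ N ℤ.- + m ℤ.- + 3 ℤ.* + n) (+ m)
      *ˢ binom (q ^ˢ 3) (⌊⅔ + N ⌋ ℤ.- + m ℤ.- + n) (+ n)
  term₀₋₁ m n =
    q ^ˢ (Q m n ∸ n)
      *ˢ binom q (+ N ℤ.+ + 1 ℤ.- + 3 ℤ.* + n ℤ.- + m) (+ m)
      *ˢ binom (q ^ˢ 3) (⌊⅔ + N ℤ.+ + 2 ⌋ ℤ.- + m ℤ.- + n) (+ n)
  term₃₅ m n =
    q ^ˢ (Q m n ℕ.+ 3 ℕ.* m ℕ.+ 5 ℕ.* n)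
      *ˢ binom q (+ N ℤ.- + 3 ℤ.* + n ℤ.- + m ℤ.- + 2) (+ m)
      *ˢ binom (q ^ˢ 3) (⌊⅔ + N ℤ.- + 1 ⌋ ℤ.- + m ℤ.- + n) (+ n)
  term₀₂ m n =
    q ^ˢ (Q m n ℕ.+ 2 ℕ.* n)
      *ˢ binom q (+ N ℤ.+ + 1 ℤ.- + m ℤ.- + 3 ℤ.* + n) (+ m)
      *ˢ binom (q ^ˢ 3) (⌊⅔ + N ℤ.- + 1 ⌋ ℤ.+ + 1 ℤ.- + m ℤ.- + n) (+ n)

  term₁₃-zero : ∀ n → term₁₃ 0 n ≈ term₂₃ 0 n
  term₁₃-zero n = S.*-congʳ {binom (q ^ˢ 3) (⌊⅔ + N ⌋ ℤ.- + 0 ℤ.- + n) (+ n)}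
    (S.*-congˡ {q ^ˢ (Q 0 n ℕ.+ 0 ℕ.+ 3 ℕ.* n)} (begin
      binom q (+ N ℤ.- + 0 ℤ.- + 3 ℤ.* + n) (+ 0)
        ≈⟨ binom★-pred-0 q refl (+ N ℤ.- + 0 ℤ.- + 3 ℤ.* + n) ⟩
      binom★ q (+ N ℤ.- + 0 ℤ.- + 3 ℤ.* + n ℤ.- + 1) (+ 0)
        ≡⟨ cong (λ k → binom★ q k (+ 0)) (upper (+ N) (+ n)) ⟩
      binom★ q (+ N ℤ.- + 3 ℤ.* + n ℤ.- + 0 ℤ.- + 1) (+ 0) ∎))
    where
    open ≈-Reasoning
    upper : ∀ N n → N ℤ.- + 0 ℤ.- + 3 ℤ.* n ℤ.- + 1 ≡ N ℤ.- + 3 ℤ.* n ℤ.- + 0 ℤ.- + 1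
    upper = ℤ-Solver.solve-∀

  term₁₃-suc : ∀ m n → term₁₃ (suc m) n ≈ term₂₃ (suc m) n +ˢ q ^ˢ 2 *ˢ term₃₆ m n
  term₁₃-suc m n = begin
    term₁₃ (suc m) n
      ≈⟨ split-middle (Q (suc m) n ℕ.+ suc m ℕ.+ 3 ℕ.* n) (Q (suc m) n ℕ.+ 2 ℕ.* suc m ℕ.+ 3 ℕ.* n)
           (Q m n ℕ.+ 3 ℕ.* m ℕ.+ 6 ℕ.* n) (suc m) (c (⌊⅔ + N ⌋ ℤ.- + suc m ℤ.- + n))
           (pascal q refl k m) (exponent₁ m n) (exponent₂ m n) ⟩
    x (binom q (k ℤ.- 1ℤ) (+ suc m)) +ˢ y (k ℤ.- 1ℤ) (⌊⅔ + N ⌋ ℤ.- + suc m ℤ.- + n)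
      ≡⟨ cong₂ (λ b z → x b +ˢ z)
          (trans (sym (binom★-suc q (k ℤ.- 1ℤ) m))
                 (cong (λ i → binom★ q i (+ suc m)) (upper₁ (+ N) (+ n) (+ m))))
          (cong₂ y (upper₂ (+ N) (+ n) (+ m)) (upper₃ ⌊⅔ + N ⌋ (+ n) (+ m))) ⟩
    term₂₃ (suc m) n +ˢ q ^ˢ 2 *ˢ term₃₆ m n ∎
    where
    open ≈-Reasoning
    k : ℤ
    k = + N ℤ.- + suc m ℤ.- + 3 ℤ.* + n
    c : ℤ → Series
    c i = binom (q ^ˢ 3) i (+ n)
    x : Series → Series
    x b = q ^ˢ (Q (suc m) n ℕ.+ 2 ℕ.* suc m ℕ.+ 3 ℕ.* n) *ˢ b *ˢ c (⌊⅔ + N ⌋ ℤ.- + suc m ℤ.- + n)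
    y : ℤ → ℤ → Series
    y i j = q ^ˢ 2 *ˢ (q ^ˢ (Q m n ℕ.+ 3 ℕ.* m ℕ.+ 6 ℕ.* n) *ˢ binom q i (+ m) *ˢ c j)
    upper₁ : ∀ N n m → N ℤ.- (1ℤ ℤ.+ m) ℤ.- + 3 ℤ.* n ℤ.- 1ℤ ≡ N ℤ.- + 3 ℤ.* n ℤ.- (1ℤ ℤ.+ m) ℤ.- + 1
    upper₁ = ℤ-Solver.solve-∀
    upper₂ : ∀ N n m → N ℤ.- (1ℤ ℤ.+ m) ℤ.- + 3 ℤ.* n ℤ.- 1ℤ ≡ N ℤ.- + 3 ℤ.* n ℤ.- m ℤ.- + 2
    upper₂ = ℤ-Solver.solve-∀
    upper₃ : ∀ M n m → M ℤ.- (1ℤ ℤ.+ m) ℤ.- n ≡ M ℤ.- + 1 ℤ.- m ℤ.- n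
    upper₃ = ℤ-Solver.solve-∀
    exponent₁ : ∀ m n →
      (suc m ℕ.* suc m ℕ.+ 3 ℕ.* suc m ℕ.* n ℕ.+ 3 ℕ.* n ℕ.* n) ℕ.+ suc m ℕ.+ 3 ℕ.* n ℕ.+ suc m
      ≡ (suc m ℕ.* suc m ℕ.+ 3 ℕ.* suc m ℕ.* n ℕ.+ 3 ℕ.* n ℕ.* n) ℕ.+ 2 ℕ.* suc m ℕ.+ 3 ℕ.* n
    exponent₁ = ℕ-Solver.solve-∀
    exponent₂ : ∀ m n →
      (suc m ℕ.* suc m ℕ.+ 3 ℕ.* suc m ℕ.* n ℕ.+ 3 ℕ.* n ℕ.* n) ℕ.+ suc m ℕ.+ 3 ℕ.* n
      ≡ 2 ℕ.+ ((m ℕ.* m ℕ.+ 3 ℕ.* m ℕ.* n ℕ.+ 3 ℕ.* n ℕ.* n) ℕ.+ 3 ℕ.* m ℕ.+ 6 ℕ.* n)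
    exponent₂ = ℕ-Solver.solve-∀

  term₀₋₁-zero : ∀ m → term₀₋₁ m 0 ≈ term₀₂ m 0
  term₀₋₁-zero m = begin
    e (Q m 0) *ˢ b (+ N ℤ.+ + 1 ℤ.- + 3 ℤ.* + 0 ℤ.- + m) *ˢ c K
      ≡⟨ cong₂ (λ i k → e i *ˢ b k *ˢ c K) (sym (ℕ.+-identityʳ (Q m 0))) (upper (+ N) (+ m)) ⟩
    e (Q m 0 ℕ.+ 2 ℕ.* 0) *ˢ b k *ˢ c K
      ≈⟨ lower ⟩
    e (Q m 0 ℕ.+ 2 ℕ.* 0) *ˢ b k *ˢ c (K ℤ.- 1ℤ)
      ≡⟨ cong (λ i → e (Q m 0 ℕ.+ 2 ℕ.* 0) *ˢ b k *ˢ c i)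
          (trans (cong (λ M → M ℤ.- + m ℤ.- + 0 ℤ.- 1ℤ) (⌊⅔⌋-shift N))
                 (upper-c ⌊⅔ + N ℤ.- + 1 ⌋ (+ m))) ⟩
    term₀₂ m 0 ∎
    where
    open ≈-Reasoning
    e : ℕ → Series
    e i = q ^ˢ i
    b c : ℤ → Series
    b i = binom q i (+ m)
    c i = binom (q ^ˢ 3) i (+ 0)
    k K : ℤ
    k = + N ℤ.+ + 1 ℤ.- + m ℤ.- + 3 ℤ.* + 0
    K = ⌊⅔ + N ℤ.+ + 2 ⌋ ℤ.- + m ℤ.- + 0
    upper : ∀ N m → N ℤ.+ + 1 ℤ.- + 3 ℤ.* + 0 ℤ.- m ≡ N ℤ.+ + 1 ℤ.- m ℤ.- + 3 ℤ.* + 0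
    upper = ℤ-Solver.solve-∀
    upper-c : ∀ M m → M ℤ.+ + 2 ℤ.- m ℤ.- + 0 ℤ.- 1ℤ ≡ M ℤ.+ + 1 ℤ.- m ℤ.- + 0
    upper-c = ℤ-Solver.solve-∀

    floor≡m : K ≡ 0ℤ → ⌊⅔ + N ℤ.+ + 2 ⌋ ≡ + m
    floor≡m K≡0 = ℤ.i-j≡0⇒i≡j ⌊⅔ + N ℤ.+ + 2 ⌋ (+ m) (trans (sym (ℤ.+-identityʳ _)) K≡0)
    k<m : K ≡ 0ℤ → k ℤ.< + m
    k<m K≡0 = subst₂ ℤ._<_ (rearrange (+ N ℤ.+ + 1) (+ m)) (half (+ m))
      (ℤ.+-monoˡ-< (ℤ.- (+ m)) (subst (λ M → + N ℤ.+ + 1 ℤ.< M ℤ.+ M) (floor≡m K≡0) (⌊⅔⌋-lower N)))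
      where
      rearrange : ∀ i m → i ℤ.- m ≡ i ℤ.- m ℤ.- + 3 ℤ.* + 0
      rearrange = ℤ-Solver.solve-∀
      half : ∀ m → m ℤ.+ m ℤ.- m ≡ m
      half = ℤ-Solver.solve-∀

    -- The coefficients [K; 0] and [K-1; 0] in q³ differ only at K = 0, and then m is so
    -- large that the coefficient in q vanishes.
    lower : e (Q m 0 ℕ.+ 2 ℕ.* 0) *ˢ b k *ˢ c K ≈ e (Q m 0 ℕ.+ 2 ℕ.* 0) *ˢ b k *ˢ c (K ℤ.- 1ℤ)
    lower with K ℤ.≟ 0ℤ
    ... | no  K≢0 = S.*-congˡ {e (Q m 0 ℕ.+ 2 ℕ.* 0) *ˢ b k} (binom-pred-0 (q ^ˢ 3) refl K K≢0)
    ... | yes K≡0 = S.trans (vanish (c K)) (S.sym (vanish (c (K ℤ.- 1ℤ))))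
      where
      vanish : ∀ f → e (Q m 0 ℕ.+ 2 ℕ.* 0) *ˢ b k *ˢ f ≈ 0ˢ
      vanish f = begin
        e (Q m 0 ℕ.+ 2 ℕ.* 0) *ˢ b k *ˢ f
          ≡⟨ cong (λ z → e (Q m 0 ℕ.+ 2 ℕ.* 0) *ˢ z *ˢ f) (binom-below q (k<m K≡0)) ⟩
        e (Q m 0 ℕ.+ 2 ℕ.* 0) *ˢ 0ˢ *ˢ f
          ≈⟨ S.*-congʳ {f} (S.zeroʳ (e (Q m 0 ℕ.+ 2 ℕ.* 0))) ⟩
        0ˢ *ˢ f
          ≈⟨ S.zeroˡ f ⟩
        0ˢ ∎

  term₀₋₁-suc : ∀ m n → term₀₋₁ m (suc n) ≈ term₀₂ m (suc n) +ˢ q ^ˢ 2 *ˢ term₃₅ m n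
  term₀₋₁-suc m n = begin
    term₀₋₁ m (suc n)
      ≈⟨ split-last (Q m (suc n) ∸ suc n) (Q m (suc n) ℕ.+ 2 ℕ.* suc n)
           (Q m n ℕ.+ 3 ℕ.* m ℕ.+ 5 ℕ.* n) (suc n ℕ.* 3) (b k) recurrence exponent₁ exponent₂ ⟩
    x k (K ℤ.- 1ℤ) +ˢ y k (K ℤ.- 1ℤ)
      ≡⟨ cong₂ _+ˢ_
          (cong₂ x (upper₁ (+ N) (+ n) (+ m))
            (trans (cong (λ M → M ℤ.- + m ℤ.- + suc n ℤ.- 1ℤ) (⌊⅔⌋-shift N))
                   (upper₂ ⌊⅔ + N ℤ.- + 1 ⌋ (+ n) (+ m))))
          (cong₂ y (upper₃ (+ N) (+ n) (+ m))
            (trans (cong (λ M → M ℤ.- + m ℤ.- + suc n ℤ.- 1ℤ) (⌊⅔⌋-shift N))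
                   (upper₄ ⌊⅔ + N ℤ.- + 1 ⌋ (+ n) (+ m)))) ⟩
    term₀₂ m (suc n) +ˢ q ^ˢ 2 *ˢ term₃₅ m n ∎
    where
    open ≈-Reasoning
    k K : ℤ
    k = + N ℤ.+ + 1 ℤ.- + 3 ℤ.* + suc n ℤ.- + m
    K = ⌊⅔ + N ℤ.+ + 2 ⌋ ℤ.- + m ℤ.- + suc n
    b : ℤ → Series
    b i = binom q i (+ m)
    x y : ℤ → ℤ → Series
    x i j = q ^ˢ (Q m (suc n) ℕ.+ 2 ℕ.* suc n) *ˢ b i *ˢ binom (q ^ˢ 3) j (+ suc n)
    y i j = q ^ˢ 2 *ˢ (q ^ˢ (Q m n ℕ.+ 3 ℕ.* m ℕ.+ 5 ℕ.* n) *ˢ b i *ˢ binom (q ^ˢ 3) j (+ n))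
    recurrence : binom (q ^ˢ 3) K (+ suc n) ≈
      q ^ˢ (suc n ℕ.* 3) *ˢ binom (q ^ˢ 3) (K ℤ.- 1ℤ) (+ suc n) +ˢ binom (q ^ˢ 3) (K ℤ.- 1ℤ) (+ n)
    recurrence = S.trans (pascal (q ^ˢ 3) refl K n)
      (S.+-congʳ {binom (q ^ˢ 3) (K ℤ.- 1ℤ) (+ n)}
        (S.*-congʳ {binom (q ^ˢ 3) (K ℤ.- 1ℤ) (+ suc n)} (^ˢ-* q 3 (suc n))))
    upper₁ : ∀ N n m → N ℤ.+ + 1 ℤ.- + 3 ℤ.* (1ℤ ℤ.+ n) ℤ.- m ≡ N ℤ.+ + 1 ℤ.- m ℤ.- + 3 ℤ.* (1ℤ ℤ.+ n)
    upper₁ = ℤ-Solver.solve-∀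
    upper₂ : ∀ M n m → M ℤ.+ + 2 ℤ.- m ℤ.- (1ℤ ℤ.+ n) ℤ.- 1ℤ ≡ M ℤ.+ + 1 ℤ.- m ℤ.- (1ℤ ℤ.+ n)
    upper₂ = ℤ-Solver.solve-∀
    upper₃ : ∀ N n m → N ℤ.+ + 1 ℤ.- + 3 ℤ.* (1ℤ ℤ.+ n) ℤ.- m ≡ N ℤ.- + 3 ℤ.* n ℤ.- m ℤ.- + 2
    upper₃ = ℤ-Solver.solve-∀
    upper₄ : ∀ M n m → M ℤ.+ + 2 ℤ.- m ℤ.- (1ℤ ℤ.+ n) ℤ.- 1ℤ ≡ M ℤ.- m ℤ.- n
    upper₄ = ℤ-Solver.solve-∀
    expand : ∀ m n → m ℕ.* m ℕ.+ 3 ℕ.* m ℕ.* suc n ℕ.+ 3 ℕ.* suc n ℕ.* suc n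
      ≡ 2 ℕ.+ ((m ℕ.* m ℕ.+ 3 ℕ.* m ℕ.* n ℕ.+ 3 ℕ.* n ℕ.* n) ℕ.+ 3 ℕ.* m ℕ.+ 5 ℕ.* n) ℕ.+ suc n
    expand = ℕ-Solver.solve-∀
    -- By expand the truncated subtraction is exact.
    exponent₂ : Q m (suc n) ∸ suc n ≡ 2 ℕ.+ (Q m n ℕ.+ 3 ℕ.* m ℕ.+ 5 ℕ.* n)
    exponent₂ = trans (cong (_∸ suc n) (expand m n)) (ℕ.m+n∸n≡m _ (suc n))
    collect : ∀ a n → 2 ℕ.+ a ℕ.+ suc n ℕ.* 3 ≡ 2 ℕ.+ a ℕ.+ suc n ℕ.+ 2 ℕ.* suc n
    collect = ℕ-Solver.solve-∀
    exponent₁ : (Q m (suc n) ∸ suc n) ℕ.+ suc n ℕ.* 3 ≡ Q m (suc n) ℕ.+ 2 ℕ.* suc n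
    exponent₁ = trans (cong (ℕ._+ suc n ℕ.* 3) exponent₂)
      (trans (collect (Q m n ℕ.+ 3 ℕ.* m ℕ.+ 5 ℕ.* n) n)
             (cong (ℕ._+ 2 ℕ.* suc n) (sym (expand m n))))

  private
    vanish : ∀ f e m n g → N ℕ.< m ℕ.+ n →
      f *ˢ (q ^ˢ e *ˢ binom q (+ N ℤ.- + 3 ℤ.* + n ℤ.- + m ℤ.- + 2) (+ m) *ˢ g) ≈ 0ˢ
    vanish f e m n g N<m+n = begin
      f *ˢ (q ^ˢ e *ˢ binom q (+ N ℤ.- + 3 ℤ.* + n ℤ.- + m ℤ.- + 2) (+ m) *ˢ g)
        ≡⟨ cong (λ b → f *ˢ (q ^ˢ e *ˢ b *ˢ g)) (binom-below q (upper-negative N m n N<m+n)) ⟩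
      f *ˢ (q ^ˢ e *ˢ 0ˢ *ˢ g)
        ≈⟨ S.*-congˡ {f} (S.*-congʳ {g} (S.zeroʳ (q ^ˢ e))) ⟩
      f *ˢ (0ˢ *ˢ g)
        ≈⟨ S.*-congˡ {f} (S.zeroˡ g) ⟩
      f *ˢ 0ˢ
        ≈⟨ S.zeroʳ f ⟩
      0ˢ ∎
      where open ≈-Reasoning

  S₁₃-sum : S₁₃ N ≈ ∑ₘₙ N term₁₃
  S₁₃-sum = begin
    ∑ₘₙ N term₂₃ +ˢ q ^ˢ 2 *ˢ ∑ₘₙ N term₃₆
      ≈⟨ S.+-congˡ {∑ₘₙ N term₂₃} (*ˢ-∑∑ (q ^ˢ 2) (suc N) term₃₆) ⟩
    ∑ₘₙ N term₂₃ +ˢ ∑ₘₙ N (λ m n → q ^ˢ 2 *ˢ term₃₆ m n)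
      ≈⟨ ∑∑-shiftˡ term₁₃ term₂₃ (λ m n → q ^ˢ 2 *ˢ term₃₆ m n) (suc N) term₁₃-zero term₁₃-suc
          (λ n → vanish (q ^ˢ 2) (Q (suc N) n ℕ.+ 3 ℕ.* suc N ℕ.+ 6 ℕ.* n) (suc N) n
            (binom (q ^ˢ 3) (⌊⅔ + N ⌋ ℤ.- + 1 ℤ.- + suc N ℤ.- + n) (+ n)) (ℕ.m≤m+n (suc N) n)) ⟨
    ∑ₘₙ N term₁₃ ∎
    where open ≈-Reasoning

  S₀₋₁-sum : S₀₋₁ N ≈ ∑ₘₙ N term₀₂ +ˢ q ^ˢ 2 *ˢ S₃₅ N
  S₀₋₁-sum = begin
    ∑ₘₙ N term₀₋₁
      ≈⟨ ∑∑-shiftʳ term₀₋₁ term₀₂ (λ m n → q ^ˢ 2 *ˢ term₃₅ m n) (suc N) term₀₋₁-zero term₀₋₁-suc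
          (λ m → vanish (q ^ˢ 2) (Q m (suc N) ℕ.+ 3 ℕ.* m ℕ.+ 5 ℕ.* suc N) m (suc N)
            (binom (q ^ˢ 3) (⌊⅔ + N ℤ.- + 1 ⌋ ℤ.- + m ℤ.- + suc N) (+ suc N)) (ℕ.m≤n+m (suc N) m)) ⟩
    ∑ₘₙ N term₀₂ +ˢ ∑ₘₙ N (λ m n → q ^ˢ 2 *ˢ term₃₅ m n)
      ≈⟨ S.+-congˡ {∑ₘₙ N term₀₂} (*ˢ-∑∑ (q ^ˢ 2) (suc N) term₃₅) ⟨
    ∑ₘₙ N term₀₂ +ˢ q ^ˢ 2 *ˢ ∑ₘₙ N term₃₅ ∎
    where open ≈-Reasoning

  S₀₂-sum : S₀₂ N ≈ ∑ₘₙ N term₀₂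
  S₀₂-sum d = trans (cong (ℤ._- (q ^ˢ 2 *ˢ S₃₅ N) d) (S₀₋₁-sum d))
    (cancel (∑ₘₙ N term₀₂ d) ((q ^ˢ 2 *ˢ S₃₅ N) d))
    where
    cancel : ∀ a b → a ℤ.+ b ℤ.- b ≡ a
    cancel = ℤ-Solver.solve-∀

proposition4p2 : (N : ℕ) →
    (S₁₃ N ≈ ∑ₘₙ N (λ m n →
    q ^ˢ (Q m n ℕ.+ m ℕ.+ 3 ℕ.* n)
    *ˢ binom q (+ N ℤ.- + m ℤ.- + 3 ℤ.* + n) (+ m)
    *ˢ binom (q ^ˢ 3) (⌊⅔ + N ⌋ ℤ.- + m ℤ.- + n) (+ n)))
    ×
    (S₀₂ N ≈ ∑ₘₙ N (λ m n →
    q ^ˢ (Q m n ℕ.+ 2 ℕ.* n)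
    *ˢ binom q (+ N ℤ.+ + 1 ℤ.- + m ℤ.- + 3 ℤ.* + n) (+ m)
    *ˢ binom (q ^ˢ 3) (⌊⅔ + N ℤ.- + 1 ⌋ ℤ.+ + 1 ℤ.- + m ℤ.- + n) (+ n)))
proposition4p2 N = S₁₃-sum N , S₀₂-sum N
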